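{- Let $n\ge1$. Then there exist graphs $F_1=F_1(n)$ and $F_2=F_2(n)$ such that for all graphs $G$ and $H$ with $|V(G)|=|V(H)|=n$: if $\hom(F_i,G)=\hom(F_i,H)$ for both $i\in\{1,2\}$, then $G\cong H$.
   Context: Graphs are finite, simple, undirected, with non-empty vertex set. $\hom(F,G)$ denotes the number of homomorphisms from $F$ to $G$. -}

module Defs where

open import Data.Nat using (ℕ; zero; suc; _+_; _*_)
open import Data.Bool using (Bool; true; false; _∧_; T)
open import Data.Fin using (Fin)
open import Data.Vec using (Vec; []; _∷_; lookup)
open import Data.List using (List; []; _∷_; map; concatMap; length; filter; allFin)
open import Data.Product using (Σ; _×_; _,_)
open import Function.Bundles using (_↔_; Inverse)
open import Relation.Binary.PropositionalEquality using (_≡_)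
open import Relation.Nullary using (Dec; yes; no)
open import Data.Bool.Properties using (T?)

-- A finite simple undirected graph with vertex set Fin (suc order-1)
-- (so the vertex set is non-empty), given by a symmetric irreflexive
-- Boolean adjacency relation.
record Graph : Set where
  field
    order-1 : ℕ
    adj     : Fin (suc order-1) → Fin (suc order-1) → Bool
    symm    : ∀ u v → adj u v ≡ adj v u
    irrefl  : ∀ v → adj v v ≡ false

open Graph public

∣V∣ : Graph → ℕ
∣V∣ G = suc (order-1 G)

V : Graph → Set
V G = Fin (∣V∣ G)

allVecs : (k m : ℕ) → List (Vec (Fin m) k)
allVecs zero    m = [] ∷ []
allVecs (suc k) m = concatMap (λ x → map (x ∷_) (allVecs k m)) (allFin m)

isHomB : (F G : Graph) → Vec (V G) (∣V∣ F) → Bool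
isHomB F G f =
  Data.List.foldr _∧_ true
    (concatMap (λ u → map (λ v → imp (adj F u v) (adj G (lookup f u) (lookup f v)))
                          (allFin (∣V∣ F)))
               (allFin (∣V∣ F)))
  where
    imp : Bool → Bool → Bool
    imp true  b = b
    imp false _ = true

hom : Graph → Graph → ℕ
hom F G = length (filter (λ f → T? (isHomB F G f)) (allVecs (∣V∣ F) (∣V∣ G)))

_≅_ : Graph → Graph → Set
G ≅ H = Σ (V G ↔ V H) λ φ →
  ∀ u v → adj G u v ≡ adj H (Inverse.to φ u) (Inverse.to φ v)

{-# OPTIONS --safe #-}

-- Patterns are edge lists; their homomorphism counts multiply under disjoint union.
--
-- For a pattern K, take the patterns obtained from subgraphs of (complete graph with
-- loops on n vertices) × K by merging vertices of the same colour in K.  By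
-- inclusion–exclusion, their counts into G determine the number of K-coloured maps
-- that are injective on every fibre and have prescribed adjacencies.  Hence, if G and
-- H agree on all of them, there are bijections ψ c, one for each vertex c of K, with
-- G(u, v) = H(ψ c u, ψ d v) for every edge cd of K.  Following an odd closed walk of K
-- through c shows that ψ c is an isomorphism (Lovász' cancellation law).
--
-- Finitely many positive counts, bounded in terms of n, can be encoded in a single
-- count by a disjoint union with suitable multiplicities.  Zero counts would destroy
-- this, which is why two graphs are used.  F₁ bundles a long odd cycle C and the
-- patterns for K = C: all of them map to C, so they have positive counts as soon as C
-- does.  F₂ bundles K₂ and the bipartite patterns for K a single loop; these have
-- positive counts into every graph with an edge, while the remaining patterns contain
-- an odd closed walk and hence have count 0 whenever C does.

module Submission where

open import Defs
open import Data.Bool as Bool using (Bool; true; false; T; not; _∧_; _∨_; _xor_; if_then_else_)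
open import Data.Bool.ListAction using (all)
open import Data.Bool.Properties using (T?; T-∧; T-∨; ∧-assoc; ∧-comm; ∧-identityʳ; ∧-zeroʳ; ∨-comm; ¬-not; not-involutive)
open import Data.Bool.Solver using (module xor-∧-Solver)
open import Data.Empty using (⊥-elim)
open import Data.Fin using (Fin; zero; suc; _≟_; _↑ˡ_; _↑ʳ_; combine; remQuot; punchOut; inject₁; fromℕ)
open import Data.Fin.Properties using (any?; combine-injectiveʳ; injective⇒≤; punchOut-injective; remQuot-combine; suc-injective; ↑ˡ-injective; ↑ʳ-injective)
open import Data.List as List using (List; []; _∷_; allFin; cartesianProduct; cartesianProductWith; concatMap; filter; foldr; length; tabulate)
import Data.List.Membership.DecPropositional as DecMembership
open import Data.List.Membership.Propositional using (_∈_)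
open import Data.List.Membership.Propositional.Properties using (∈-allFin; ∈-map⁺; ∈-++⁺ˡ; ∈-++⁺ʳ; ∈-cartesianProduct⁺; ∈-cartesianProductWith⁺)
import Data.List.Properties as List
open import Data.List.Relation.Unary.All as All using (All; []; _∷_)
import Data.List.Relation.Unary.All.Properties as All
open import Data.List.Relation.Unary.Any as Any using (here; there)
open import Data.Nat using (ℕ; zero; suc; _+_; _*_; _^_; _≤_; _<_; _>_; _≥_; z≤n; z<s; >-nonZero)
open import Data.Nat.Properties hiding (_≟_; suc-injective)
open import Data.Product as Product using (Σ; ∃; ∃₂; _×_; _,_; proj₁; proj₂; -,_)
open import Data.Product.Properties using (≡-dec)
open import Data.Sum as Sum using (_⊎_; inj₁; inj₂)
open import Data.Unit using (tt)
open import Data.Vec as Vec using (Vec; []; _∷_; _++_; _[_]≔_; lookup)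
import Data.Vec.Properties as Vec
open import Function using (_∘_; id; mk↔ₛ′; _↔_; Equivalence; Inverse)
open import Function.Definitions using (Injective)
open import Relation.Binary.Definitions using (tri<; tri≈; tri>)
open import Relation.Binary.PropositionalEquality
open import Relation.Nullary using (¬_; Dec; yes; no; does; contradiction)
open import Relation.Nullary.Decidable using (dec-true; dec-false)
open import Algebra.Properties.Semiring.Sum +-*-semiring using (sum; sum-cong-≗; ∑-distrib-+; *-distribˡ-sum; sum-replicate-zero)
open xor-∧-Solver using (solve; con; _:+_; _:=_)

-- Sums over finite sets and over vectors.

indicator : Bool → ℕ
indicator true  = 1
indicator false = 0

sum-const : ∀ n c → sum {n} (λ _ → c) ≡ n * c
sum-const zero    c = refl
sum-const (suc n) c = cong (c +_) (sum-const n c)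

sum-indicator : ∀ {n} (x : Fin n) (f : Fin n → ℕ) →
                sum (λ y → indicator (does (x ≟ y)) * f y) ≡ f x
sum-indicator {suc n} zero    f = begin
  f zero + 0 + sum {n} (λ _ → 0)  ≡⟨ cong (f zero + 0 +_) (sum-replicate-zero n) ⟩
  f zero + 0 + 0                  ≡⟨ trans (+-identityʳ _) (+-identityʳ _) ⟩
  f zero                          ∎
  where open ≡-Reasoning
sum-indicator {suc n} (suc x) f = sum-indicator x (f ∘ suc)

term≤sum : ∀ {n} (f : Fin n → ℕ) x → f x ≤ sum f
term≤sum f zero    = m≤m+n (f zero) _
term≤sum f (suc x) = ≤-trans (term≤sum (f ∘ suc) x) (m≤n+m _ (f zero))

sum>0⇒term>0 : ∀ {n} (f : Fin n → ℕ) → sum f > 0 → ∃ λ x → f x > 0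
sum>0⇒term>0 {suc n} f pos with f zero in eq
... | suc _ = zero , subst (_> 0) (sym eq) z<s
... | zero  = Product.map suc id (sum>0⇒term>0 (f ∘ suc) pos)

sum≤ : ∀ {n} {c} (f : Fin n → ℕ) → (∀ x → f x ≤ c) → sum f ≤ n * c
sum≤ {zero}  f f≤c = z≤n
sum≤ {suc n} f f≤c = +-mono-≤ (f≤c zero) (sum≤ (f ∘ suc) (f≤c ∘ suc))

∑ⱽ : ∀ {k n} → (Vec (Fin n) k → ℕ) → ℕ
∑ⱽ {zero}  f = f []
∑ⱽ {suc k} f = sum (λ x → ∑ⱽ (f ∘ (x ∷_)))

∑ⱽ-cong : ∀ {k n} {f g : Vec (Fin n) k → ℕ} → (∀ v → f v ≡ g v) → ∑ⱽ f ≡ ∑ⱽ g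
∑ⱽ-cong {zero}  f≗g = f≗g []
∑ⱽ-cong {suc k} f≗g = sum-cong-≗ (λ x → ∑ⱽ-cong (f≗g ∘ (x ∷_)))

∑ⱽ-distrib-+ : ∀ {k n} (f g : Vec (Fin n) k → ℕ) → ∑ⱽ (λ v → f v + g v) ≡ ∑ⱽ f + ∑ⱽ g
∑ⱽ-distrib-+ {zero}  f g = refl
∑ⱽ-distrib-+ {suc k} f g =
  trans (sum-cong-≗ (λ x → ∑ⱽ-distrib-+ (f ∘ (x ∷_)) (g ∘ (x ∷_))))
        (∑-distrib-+ (λ x → ∑ⱽ (f ∘ (x ∷_))) (λ x → ∑ⱽ (g ∘ (x ∷_))))

*-distribˡ-∑ⱽ : ∀ {k n} c (f : Vec (Fin n) k → ℕ) → c * ∑ⱽ f ≡ ∑ⱽ (λ v → c * f v)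
*-distribˡ-∑ⱽ {zero}  c f = refl
*-distribˡ-∑ⱽ {suc k} c f =
  trans (*-distribˡ-sum c (λ x → ∑ⱽ (f ∘ (x ∷_)))) (sum-cong-≗ (λ x → *-distribˡ-∑ⱽ c (f ∘ (x ∷_))))

*-distribʳ-∑ⱽ : ∀ {k n} c (f : Vec (Fin n) k → ℕ) → ∑ⱽ f * c ≡ ∑ⱽ (λ v → f v * c)
*-distribʳ-∑ⱽ c f = trans (*-comm (∑ⱽ f) c)
  (trans (*-distribˡ-∑ⱽ c f) (∑ⱽ-cong (λ v → *-comm c (f v))))

∑ⱽ-sum-swap : ∀ {k n m} (f : Vec (Fin n) k → Fin m → ℕ) →
              ∑ⱽ (λ v → sum (f v)) ≡ sum (λ y → ∑ⱽ (λ v → f v y))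
∑ⱽ-sum-swap {k} {m = zero}  f = sym (*-distribˡ-∑ⱽ 0 (λ v → sum (f v)))
∑ⱽ-sum-swap {m = suc m} f =
  trans (∑ⱽ-distrib-+ (λ v → f v zero) (λ v → sum (f v ∘ suc)))
        (cong (∑ⱽ (λ v → f v zero) +_) (∑ⱽ-sum-swap (λ v → f v ∘ suc)))

∑ⱽ-++ : ∀ k {l n} (f : Vec (Fin n) (k + l) → ℕ) →
        ∑ⱽ f ≡ ∑ⱽ {k} (λ v → ∑ⱽ {l} (λ w → f (v ++ w)))
∑ⱽ-++ zero    f = refl
∑ⱽ-++ (suc k) f = sum-cong-≗ (λ x → ∑ⱽ-++ k (f ∘ (x ∷_)))

-- Each vector arises from exactly n choices of `v` and `y`, one for every value that the
-- overwritten entry of `v` may have had.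
∑ⱽ-update : ∀ {k n} (j : Fin k) (f : Vec (Fin n) k → ℕ) →
            ∑ⱽ (λ v → sum (λ y → f (v [ j ]≔ y))) ≡ n * ∑ⱽ f
∑ⱽ-update {n = n} zero f = begin
  sum {n} (λ _ → ∑ⱽ (λ v → sum (λ y → f (y ∷ v))))  ≡⟨ sum-const n _ ⟩
  n * ∑ⱽ (λ v → sum (λ y → f (y ∷ v)))              ≡⟨ cong (n *_) (∑ⱽ-sum-swap (λ v y → f (y ∷ v))) ⟩
  n * sum (λ y → ∑ⱽ (f ∘ (y ∷_)))                   ∎
  where open ≡-Reasoning
∑ⱽ-update {n = n} (suc j) f =
  trans (sum-cong-≗ (λ x → ∑ⱽ-update j (f ∘ (x ∷_))))
        (sym (*-distribˡ-sum n (λ x → ∑ⱽ (f ∘ (x ∷_)))))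

term≤∑ⱽ : ∀ {k n} (f : Vec (Fin n) k → ℕ) v → f v ≤ ∑ⱽ f
term≤∑ⱽ f []      = ≤-refl
term≤∑ⱽ f (x ∷ v) = ≤-trans (term≤∑ⱽ (f ∘ (x ∷_)) v) (term≤sum (λ y → ∑ⱽ (f ∘ (y ∷_))) x)

∑ⱽ>0⇒term>0 : ∀ {k n} (f : Vec (Fin n) k → ℕ) → ∑ⱽ f > 0 → ∃ λ v → f v > 0
∑ⱽ>0⇒term>0 {zero}  f pos = [] , pos
∑ⱽ>0⇒term>0 {suc k} f pos with sum>0⇒term>0 (λ x → ∑ⱽ (f ∘ (x ∷_))) pos
... | x , pos′ = Product.map (x ∷_) id (∑ⱽ>0⇒term>0 (f ∘ (x ∷_)) pos′)

∑ⱽ≤ : ∀ {k n} (f : Vec (Fin n) k → ℕ) → (∀ v → f v ≤ 1) → ∑ⱽ f ≤ n ^ k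
∑ⱽ≤ {zero}  f f≤1 = f≤1 []
∑ⱽ≤ {suc k} f f≤1 = sum≤ (λ x → ∑ⱽ (f ∘ (x ∷_))) (λ x → ∑ⱽ≤ (f ∘ (x ∷_)) (f≤1 ∘ (x ∷_)))

count : ∀ {k n} → (Vec (Fin n) k → Bool) → ℕ
count p = ∑ⱽ (indicator ∘ p)

count>0⇒∃ : ∀ {k n} (p : Vec (Fin n) k → Bool) → count p > 0 → ∃ λ v → T (p v)
count>0⇒∃ p pos with ∑ⱽ>0⇒term>0 (indicator ∘ p) pos
... | v , pos′ = v , lem (p v) pos′
  where
  lem : ∀ b → indicator b > 0 → T b
  lem true _ = tt

∃⇒count>0 : ∀ {k n} (p : Vec (Fin n) k → Bool) v → T (p v) → count p > 0
∃⇒count>0 p v pv = ≤-trans (lem (p v) pv) (term≤∑ⱽ (indicator ∘ p) v)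
  where
  lem : ∀ b → T b → indicator b > 0
  lem true _ = z<s

indicator≤1 : ∀ b → indicator b ≤ 1
indicator≤1 true  = ≤-refl
indicator≤1 false = z≤n

-- Lengths of filtered lists as sums.

length-filter-concat-tabulate : ∀ {A : Set} {n} (p : A → Bool) (g : Fin n → List A) →
  length (filter (T? ∘ p) (List.concat (tabulate g))) ≡ sum (λ x → length (filter (T? ∘ p) (g x)))
length-filter-concat-tabulate {n = zero}  p g = refl
length-filter-concat-tabulate {n = suc n} p g = begin
  length (filter (T? ∘ p) (g zero List.++ rest))                          ≡⟨ cong length (List.filter-++ (T? ∘ p) (g zero) rest) ⟩
  length (filter (T? ∘ p) (g zero) List.++ filter (T? ∘ p) rest)          ≡⟨ List.length-++ (filter (T? ∘ p) (g zero)) ⟩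
  length (filter (T? ∘ p) (g zero)) + length (filter (T? ∘ p) rest)       ≡⟨ cong (length (filter (T? ∘ p) (g zero)) +_) (length-filter-concat-tabulate p (g ∘ suc)) ⟩
  sum (λ x → length (filter (T? ∘ p) (g x)))                              ∎
  where
  open ≡-Reasoning
  rest = List.concat (tabulate (g ∘ suc))

length-filter-map : ∀ {A B : Set} (p : B → Bool) (f : A → B) xs →
  length (filter (T? ∘ p) (List.map f xs)) ≡ length (filter (T? ∘ (p ∘ f)) xs)
length-filter-map p f []       = refl
length-filter-map p f (x ∷ xs) with p (f x)
... | true  = cong suc (length-filter-map p f xs)
... | false = length-filter-map p f xs

length-filter-allVecs : ∀ k {n} (p : Vec (Fin n) k → Bool) →
                        length (filter (T? ∘ p) (allVecs k n)) ≡ count p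
length-filter-allVecs zero p with p []
... | true  = refl
... | false = refl
length-filter-allVecs (suc k) {n} p = begin
  length (filter (T? ∘ p) (concatMap extend (List.allFin n)))   ≡⟨ cong (λ xss → length (filter (T? ∘ p) (List.concat xss))) (List.map-tabulate id extend) ⟩
  length (filter (T? ∘ p) (List.concat (tabulate extend)))      ≡⟨ length-filter-concat-tabulate p extend ⟩
  sum (λ x → length (filter (T? ∘ p) (extend x)))               ≡⟨ sum-cong-≗ (λ x → trans (length-filter-map p (x ∷_) (allVecs k n)) (length-filter-allVecs k (p ∘ (x ∷_)))) ⟩
  count p                                                       ∎
  where
  open ≡-Reasoning
  extend : Fin n → List (Vec (Fin n) (suc k))
  extend x = List.map (x ∷_) (allVecs k n)

-- Patterns and their homomorphism counts

-- Entries are directed, and loops and repetitions are allowed: the one-vertex pattern `loop` is a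
-- loop, and merging vertices creates further ones.
Pattern : ℕ → Set
Pattern k = List (Fin k × Fin k)

Adj : ℕ → Set
Adj n = Fin n → Fin n → Bool

Symmetric : ∀ {n} → Adj n → Set
Symmetric A = ∀ u v → A u v ≡ A v u

Loopless : ∀ {k} → Pattern k → Set
Loopless = All (λ (u , v) → u ≢ v)

module _ {n} (A : Adj n) where

  respects : ∀ {k} → (Fin k → Fin n) → Pattern k → Bool
  respects φ = all (λ (u , v) → A (φ u) (φ v))

  opaque

    homs : ∀ {k} → Pattern k → ℕ
    homs L = count (λ v → respects (lookup v) L)

  respects-cong : ∀ {k} {φ ψ : Fin k → Fin n} → (∀ x → φ x ≡ ψ x) →
                  ∀ L → respects φ L ≡ respects ψ L
  respects-cong φ≗ψ []            = refl
  respects-cong φ≗ψ ((u , v) ∷ L) = cong₂ _∧_ (cong₂ A (φ≗ψ u) (φ≗ψ v)) (respects-cong φ≗ψ L)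

  respects⁻ : ∀ {k} (φ : Fin k → Fin n) {L} → T (respects φ L) →
              All (λ (u , v) → T (A (φ u) (φ v))) L
  respects⁻ φ {L} = All.all⁺ (λ (u , v) → A (φ u) (φ v)) L

  respects⁺ : ∀ {k} (φ : Fin k → Fin n) {L} → All (λ (u , v) → T (A (φ u) (φ v))) L →
              T (respects φ L)
  respects⁺ φ = All.all⁻ (λ (u , v) → A (φ u) (φ v))

  opaque
    unfolding homs

    homs>0⁺ : ∀ {k} {L : Pattern k} (φ : Fin k → Fin n) →
              All (λ (u , v) → T (A (φ u) (φ v))) L → homs L > 0
    homs>0⁺ {L = L} φ h = ∃⇒count>0 (λ v → respects (lookup v) L) (Vec.tabulate φ)
      (subst T (respects-cong (λ x → sym (Vec.lookup∘tabulate φ x)) L)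
             (respects⁺ φ h))

    homs>0⁻ : ∀ {k} {L : Pattern k} → homs L > 0 →
              ∃ λ (φ : Fin k → Fin n) → All (λ (u , v) → T (A (φ u) (φ v))) L
    homs>0⁻ {L = L} pos with v , h ← count>0⇒∃ (λ v → respects (lookup v) L) pos =
      lookup v , respects⁻ (lookup v) h

    homs≤ : ∀ {k} (L : Pattern k) → homs L ≤ n ^ k
    homs≤ L = ∑ⱽ≤ _ (λ v → indicator≤1 (respects (lookup v) L))

-- Renaming of vertices and disjoint unions.

rename : ∀ {k l} → (Fin k → Fin l) → Pattern k → Pattern l
rename ρ = List.map (Product.map ρ ρ)

respects-rename : ∀ {n k l} (A : Adj n) (φ : Fin l → Fin n) (ρ : Fin k → Fin l) L →
                  respects A φ (rename ρ L) ≡ respects A (φ ∘ ρ) L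
respects-rename A φ ρ []            = refl
respects-rename A φ ρ ((u , v) ∷ L) = cong (A (φ (ρ u)) (φ (ρ v)) ∧_) (respects-rename A φ ρ L)

respects-++ : ∀ {n k} (A : Adj n) (φ : Fin k → Fin n) L L′ →
              respects A φ (L List.++ L′) ≡ respects A φ L ∧ respects A φ L′
respects-++ A φ []            L′ = refl
respects-++ A φ ((u , v) ∷ L) L′ =
  trans (cong (A (φ u) (φ v) ∧_) (respects-++ A φ L L′)) (sym (∧-assoc (A (φ u) (φ v)) _ _))

rename-loopless : ∀ {k l} {ρ : Fin k → Fin l} → (∀ {x y} → ρ x ≡ ρ y → x ≡ y) →
                  ∀ {L} → Loopless L → Loopless (rename ρ L)
rename-loopless inj h = All.map⁺ (All.map (_∘ inj) h)

infixr 5 _⊔ᴾ_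
_⊔ᴾ_ : ∀ {k l} → Pattern k → Pattern l → Pattern (k + l)
_⊔ᴾ_ {k} {l} L L′ = rename (_↑ˡ l) L List.++ rename (k ↑ʳ_) L′

indicator-∧ : ∀ a b → indicator (a ∧ b) ≡ indicator a * indicator b
indicator-∧ true  b = sym (*-identityˡ _)
indicator-∧ false b = refl

opaque
  unfolding homs

  homs-⊔ : ∀ {n k l} (A : Adj n) (L : Pattern k) (L′ : Pattern l) →
           homs A (L ⊔ᴾ L′) ≡ homs A L * homs A L′
  homs-⊔ {n} {k} {l} A L L′ = begin
    homs A (L ⊔ᴾ L′)
      ≡⟨ ∑ⱽ-++ k (λ v → indicator (respects A (lookup v) (L ⊔ᴾ L′))) ⟩
    ∑ⱽ {k} (λ v → ∑ⱽ {l} (λ w → indicator (respects A (lookup (v ++ w)) (L ⊔ᴾ L′))))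
      ≡⟨ ∑ⱽ-cong (λ v → ∑ⱽ-cong (λ w → trans (cong indicator (split v w)) (indicator-∧ (respects A (lookup v) L) _))) ⟩
    ∑ⱽ {k} (λ v → ∑ⱽ {l} (λ w → indicator (respects A (lookup v) L) * indicator (respects A (lookup w) L′)))
      ≡⟨ ∑ⱽ-cong (λ v → *-distribˡ-∑ⱽ (indicator (respects A (lookup v) L)) (λ w → indicator (respects A (lookup w) L′))) ⟨
    ∑ⱽ {k} (λ v → indicator (respects A (lookup v) L) * homs A L′)
      ≡⟨ *-distribʳ-∑ⱽ (homs A L′) (λ v → indicator (respects A (lookup v) L)) ⟨
    homs A L * homs A L′ ∎
    where
    open ≡-Reasoning
    split : ∀ v w → respects A (lookup (v ++ w)) (L ⊔ᴾ L′) ≡ respects A (lookup v) L ∧ respects A (lookup w) L′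
    split v w = trans (respects-++ A (lookup (v ++ w)) (rename (_↑ˡ l) L) _)
      (cong₂ _∧_
        (trans (respects-rename A (lookup (v ++ w)) (_↑ˡ l) L) (respects-cong A (Vec.lookup-++ˡ v w) L))
        (trans (respects-rename A (lookup (v ++ w)) (k ↑ʳ_) L′) (respects-cong A (Vec.lookup-++ʳ v w) L′)))

⊔-loopless : ∀ {k l} {L : Pattern k} {L′ : Pattern l} → Loopless L → Loopless L′ → Loopless (L ⊔ᴾ L′)
⊔-loopless {k} {l} h h′ =
  All.++⁺ (rename-loopless (↑ˡ-injective l _ _) h) (rename-loopless (↑ʳ-injective k _ _) h′)

opaque
  unfolding homs

  homs-empty : ∀ {n} (A : Adj n) → homs A {0} [] ≡ 1
  homs-empty A = refl

copies : ∀ {k} m → Pattern k → Pattern (m * k)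
copies zero    L = []
copies (suc m) L = L ⊔ᴾ copies m L

homs-copies : ∀ {n k} (A : Adj n) m (L : Pattern k) → homs A (copies m L) ≡ homs A L ^ m
homs-copies A zero    L = homs-empty A
homs-copies A (suc m) L = trans (homs-⊔ A L (copies m L)) (cong (homs A L *_) (homs-copies A m L))

copies-loopless : ∀ {k} m {L : Pattern k} → Loopless L → Loopless (copies m L)
copies-loopless zero    h = []
copies-loopless (suc m) h = ⊔-loopless h (copies-loopless m h)

-- Encoding several positive counts in one.

-- Bernoulli's inequality (1 + 1/x)^m ≥ 1 + m/x, multiplied by x^(m+1) so that no division occurs.
bernoulli : ∀ x m → x ^ m * (x + m) ≤ x * suc x ^ m
bernoulli x zero    = ≤-reflexive (trans (+-identityʳ _) (trans (+-identityʳ x) (sym (*-identityʳ x))))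
bernoulli x (suc m) = begin
  x * x ^ m * (x + suc m)          ≡⟨ trans (cong (_* (x + suc m)) (*-comm x (x ^ m))) (*-assoc (x ^ m) x _) ⟩
  x ^ m * (x * (x + suc m))        ≤⟨ *-monoʳ-≤ (x ^ m) expand ⟩
  x ^ m * ((x + m) * suc x)        ≡⟨ *-assoc (x ^ m) (x + m) (suc x) ⟨
  x ^ m * (x + m) * suc x          ≤⟨ *-monoˡ-≤ (suc x) (bernoulli x m) ⟩
  x * suc x ^ m * suc x            ≡⟨ trans (*-assoc x (suc x ^ m) (suc x)) (cong (x *_) (*-comm (suc x ^ m) (suc x))) ⟩
  x * (suc x * suc x ^ m)          ∎
  where
  open ≤-Reasoning
  expand : x * (x + suc m) ≤ (x + m) * suc x
  expand = begin
    x * (x + suc m)        ≡⟨ cong (x *_) (+-suc x m) ⟩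
    x * suc (x + m)        ≡⟨ *-suc x (x + m) ⟩
    x + x * (x + m)        ≤⟨ +-monoˡ-≤ _ (m≤m+n x m) ⟩
    (x + m) + x * (x + m)  ≡⟨ *-comm (suc x) (x + m) ⟩
    (x + m) * suc x        ∎

-- By Bernoulli the ratio of `suc x ^ m` to `x ^ m` is at least 1 + m/x, which exceeds `b` once `m`
-- is at least `b * x`.
power-gap : ∀ {b x m} → x > 0 → b * x ≤ m → b * x ^ m < suc x ^ m
power-gap {b} {x} {m} x>0 bx≤m = *-cancelˡ-< x _ _ (begin-strict
  x * (b * x ^ m)    ≡⟨ trans (sym (*-assoc x b _)) (trans (cong (_* x ^ m) (*-comm x b)) (*-comm (b * x) (x ^ m))) ⟩
  x ^ m * (b * x)    ≤⟨ *-monoʳ-≤ (x ^ m) bx≤m ⟩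
  x ^ m * m          <⟨ *-monoʳ-< (x ^ m) {{m^n≢0 x m {{>-nonZero x>0}}}} (m<n+m m x>0) ⟩
  x ^ m * (x + m)    ≤⟨ bernoulli x m ⟩
  x * suc x ^ m      ∎)
  where open ≤-Reasoning

mixed-power-< : ∀ {a b B x y X m} → a ≤ B → 0 < b → 0 < x → x ≤ X → B * X ≤ m → x < y →
                a * x ^ m < b * y ^ m
mixed-power-< {a} {b} {B} {x} {y} {X} {m} a≤B b>0 x>0 x≤X BX≤m x<y = begin-strict
  a * x ^ m    ≤⟨ *-monoˡ-≤ (x ^ m) a≤B ⟩
  B * x ^ m    <⟨ power-gap {B} x>0 (≤-trans (*-monoʳ-≤ B x≤X) BX≤m) ⟩
  suc x ^ m    ≤⟨ ^-monoˡ-≤ m x<y ⟩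
  y ^ m        ≡⟨ *-identityˡ (y ^ m) ⟨
  1 * y ^ m    ≤⟨ *-monoˡ-≤ (y ^ m) b>0 ⟩
  b * y ^ m    ∎
  where open ≤-Reasoning

-- If the bases differed, the power of the larger one would outweigh any factor up to `B`; for equal
-- bases the power cancels.
mixed-power-injective : ∀ {a b B x y X m} → 0 < a → 0 < b → a ≤ B → b ≤ B →
                        0 < x → 0 < y → x ≤ X → y ≤ X → B * X ≤ m →
                        a * x ^ m ≡ b * y ^ m → a ≡ b × x ≡ y
mixed-power-injective {a} {b} {x = x} {y} {m = m} a>0 b>0 a≤B b≤B x>0 y>0 x≤X y≤X BX≤m eq
  with <-cmp x y
... | tri< x<y _ _ = contradiction eq (<⇒≢ (mixed-power-< a≤B b>0 x>0 x≤X BX≤m x<y))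
... | tri> _ _ y<x = contradiction (sym eq) (<⇒≢ (mixed-power-< b≤B a>0 y>0 y≤X BX≤m y<x))
... | tri≈ _ refl _ = *-cancelʳ-≡ a b (x ^ m) {{m^n≢0 x m {{>-nonZero x>0}}}} eq , refl

-- The number of copies makes the map (a , x) ↦ a * x ^ m injective on the positive
-- values that homomorphism counts into graphs of order n can take.
bundle : ℕ → List (∃ Pattern) → ∃ Pattern
bundle n []             = 0 , []
bundle n ((k , L) ∷ Ls) =
  let (l , F) = bundle n Ls in -, L ⊔ᴾ copies (suc (n ^ k * n ^ l)) F

module _ {n : ℕ} where

  private
    M : ∀ k Ls → ℕ
    M k Ls = suc (n ^ k * n ^ proj₁ (bundle n Ls))

  homs-bundle-∷ : ∀ (A : Adj n) {k} (L : Pattern k) Ls →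
    homs A (proj₂ (bundle n ((k , L) ∷ Ls))) ≡ homs A L * homs A (proj₂ (bundle n Ls)) ^ M k Ls
  homs-bundle-∷ A {k} L Ls = trans (homs-⊔ A L _)
    (cong (homs A L *_) (homs-copies A (M k Ls) (proj₂ (bundle n Ls))))

  homs-bundle>0⁺ : ∀ (A : Adj n) {Ls} → All (λ (_ , L) → homs A L > 0) Ls →
                   homs A (proj₂ (bundle n Ls)) > 0
  homs-bundle>0⁺ A []                          = ≤-reflexive (sym (homs-empty A))
  homs-bundle>0⁺ A {(k , L) ∷ Ls} (pos ∷ poss) = subst (_> 0) (sym (homs-bundle-∷ A L Ls))
    (*-mono-≤ pos (m^n>0 _ {{>-nonZero (homs-bundle>0⁺ A poss)}} (M k Ls)))

  private
    -- The exponent is a successor because a zeroth power is positive whatever its base.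
    split>0 : ∀ a x m → a * x ^ suc m > 0 → a > 0 × x > 0
    split>0 (suc a) (suc x) m _   = z<s , z<s
    split>0 (suc a) zero    m pos = contradiction (subst (_> 0) (*-zeroʳ (suc a)) pos) λ ()

    headTail>0 : ∀ (A : Adj n) {k} (L : Pattern k) Ls → homs A (proj₂ (bundle n ((k , L) ∷ Ls))) > 0 →
                 homs A L > 0 × homs A (proj₂ (bundle n Ls)) > 0
    headTail>0 A {k} L Ls pos = split>0 _ _ (n ^ k * n ^ proj₁ (bundle n Ls))
      (subst (_> 0) (homs-bundle-∷ A L Ls) pos)

  -- By equality both counts are positive, hence so are all factors of both products. As counts into
  -- graphs of order n are bounded, the count of the head and that of the remaining bundle can be
  -- read off, and the induction goes on with the latter.
  bundle-injective : ∀ (A B : Adj n) {Ls} → let F = proj₂ (bundle n Ls) in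
                     homs A F > 0 → homs A F ≡ homs B F →
                     All (λ (_ , L) → homs A L ≡ homs B L) Ls
  bundle-injective A B {[]}           pos eq = []
  bundle-injective A B {(k , L) ∷ Ls} pos eq
    with pA , psA ← headTail>0 A L Ls pos
       | pB , psB ← headTail>0 B L Ls (subst (_> 0) eq pos)
    with eqL , eqF ← mixed-power-injective pA pB (homs≤ A L) (homs≤ B L) psA psB
                       (homs≤ A (proj₂ (bundle n Ls))) (homs≤ B (proj₂ (bundle n Ls))) (n≤1+n _)
                       (trans (sym (homs-bundle-∷ A L Ls)) (trans eq (homs-bundle-∷ B L Ls)))
    = eqL ∷ bundle-injective A B psA eqF

  bundle-loopless : ∀ {Ls} → All (λ (_ , L) → Loopless L) Ls → Loopless (proj₂ (bundle n Ls))
  bundle-loopless []                    = []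
  bundle-loopless {(k , L) ∷ Ls} (h ∷ hs) = ⊔-loopless h (copies-loopless (M k Ls) (bundle-loopless hs))

-- Loopless patterns as graphs.

_∈?_ : ∀ {k} (e : Fin k × Fin k) (L : Pattern k) → Dec (e ∈ L)
_∈?_ = DecMembership._∈?_ (≡-dec _≟_ _≟_)

asGraph : ∀ {k} (L : Pattern (suc k)) → Loopless L → Graph
asGraph {k} L loopless = record
  { order-1 = k
  ; adj     = λ u v → does ((u , v) ∈? L) ∨ does ((v , u) ∈? L)
  ; symm    = λ u v → ∨-comm (does ((u , v) ∈? L)) _
  ; irrefl  = λ v → let noLoop = λ v∈L → All.lookup loopless v∈L refl in
                    cong₂ _∨_ (dec-false ((v , v) ∈? L) noLoop) (dec-false ((v , v) ∈? L) noLoop)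
  }

-- The implication inside isHomB is local to its where block and cannot be named, so
-- these are stated for an arbitrary g, which unification instantiates.
module _ {A : Set} (g : A → A → Bool) {xs : List A} where

  private
    conj : List Bool → Bool
    conj = foldr _∧_ true

    conj⁻ : ∀ bs → T (conj bs) → All T bs
    conj⁻ []       _ = []
    conj⁻ (b ∷ bs) h with p , ps ← Equivalence.to (T-∧ {b}) h = p ∷ conj⁻ bs ps

    conj⁺ : ∀ {bs} → All T bs → T (conj bs)
    conj⁺ []       = tt
    conj⁺ (p ∷ ps) = Equivalence.from T-∧ (p , conj⁺ ps)

  conjunction⁻ : ∀ {ys} → T (foldr _∧_ true (concatMap (λ u → List.map (g u) ys) xs)) →
                 ∀ {u v} → u ∈ xs → v ∈ ys → T (g u v)
  conjunction⁻ h u∈ v∈ =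
    All.lookup (All.map⁻ (All.lookup (All.map⁻ (All.concat⁻ (conj⁻ _ h))) u∈)) v∈

  conjunction-or-counterexample : ∀ {ys} →
    T (foldr _∧_ true (concatMap (λ u → List.map (g u) ys) xs)) ⊎ ∃₂ λ u v → ¬ T (g u v)
  conjunction-or-counterexample {ys} with All.all? (λ u → All.all? (λ v → T? (g u v)) ys) xs
  ... | yes h = inj₁ (conj⁺ (All.concat⁺ (All.map⁺ (All.map All.map⁺ h))))
  ... | no ¬h with u , ¬hu ← Any.satisfied (All.¬All⇒Any¬ (λ u → All.all? (λ v → T? (g u v)) ys) xs ¬h)
              with v , ¬huv ← Any.satisfied (All.¬All⇒Any¬ (λ v → T? (g u v)) ys ¬hu)
              = inj₂ (u , v , ¬huv)

isHomB⁻ : ∀ F G f → T (isHomB F G f) → ∀ u v → T (adj F u v) → T (adj G (lookup f u) (lookup f v))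
isHomB⁻ F G f h u v e
  with h′ ← conjunction⁻ _ {allFin (∣V∣ F)} {allFin (∣V∣ F)} h (∈-allFin u) (∈-allFin v)
  with true ← adj F u v = h′

isHomB⁺ : ∀ F G f → (∀ u v → T (adj F u v) → T (adj G (lookup f u) (lookup f v))) → T (isHomB F G f)
isHomB⁺ F G f h with conjunction
  where
  conjunction : T (isHomB F G f) ⊎ ∃₂ λ u v → ¬ T _
  conjunction = conjunction-or-counterexample _ {allFin (∣V∣ F)} {allFin (∣V∣ F)}
... | inj₁ hom           = hom
... | inj₂ (u , v , ¬hom) with adj F u v | h u v
...   | true  | h′ = contradiction (h′ tt) ¬hom
...   | false | _  = contradiction tt ¬hom

T-injective : ∀ {a b} → (T a → T b) → (T b → T a) → a ≡ b
T-injective {true}  {true}  _ _ = refl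
T-injective {true}  {false} f _ = ⊥-elim (f tt)
T-injective {false} {true}  _ g = ⊥-elim (g tt)
T-injective {false} {false} _ _ = refl

isHomB-asGraph : ∀ {k} (L : Pattern (suc k)) (loopless : Loopless L) G f →
                 isHomB (asGraph L loopless) G f ≡ respects (adj G) (lookup f) L
isHomB-asGraph L loopless G f = T-injective to from
  where
  F = asGraph L loopless

  fromDec : ∀ {P : Set} (P? : Dec P) → P → T (does P?)
  fromDec (yes _) _ = tt
  fromDec (no ¬p) p = ¬p p

  to : T (isHomB F G f) → T (respects (adj G) (lookup f) L)
  to h = respects⁺ (adj G) (lookup f) {L} (All.tabulate λ { {u , v} e →
    isHomB⁻ F G f h u v (Equivalence.from T-∨ (inj₁ (fromDec ((u , v) ∈? L) e))) })

  from : T (respects (adj G) (lookup f) L) → T (isHomB F G f)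
  from h = isHomB⁺ F G f edge
    where
    edges = respects⁻ (adj G) (lookup f) {L} h

    edge : ∀ u v → T (adj F u v) → T (adj G (lookup f u) (lookup f v))
    edge u v e with (u , v) ∈? L | (v , u) ∈? L
    ... | yes uv∈L | _        = All.lookup edges uv∈L
    ... | no _     | yes vu∈L = subst T (symm G _ _) (All.lookup edges vu∈L)

opaque
  unfolding homs

  hom-asGraph : ∀ {k} (L : Pattern (suc k)) (loopless : Loopless L) G →
                hom (asGraph L loopless) G ≡ homs (adj G) L
  hom-asGraph {k} L loopless G = trans (length-filter-allVecs (suc k) (isHomB (asGraph L loopless) G))
    (∑ⱽ-cong (λ f → cong indicator (isHomB-asGraph L loopless G f)))

  -- The new vertex `zero` is isolated and can go to any of the n vertices.
  homs-rename-suc : ∀ {n k} (A : Adj n) (L : Pattern k) → homs A (rename suc L) ≡ n * homs A L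
  homs-rename-suc {n} A L = trans
    (sum-cong-≗ (λ x → ∑ⱽ-cong (λ v → cong indicator (respects-rename A (lookup (x ∷ v)) suc L))))
    (sum-const n (homs A L))

-- Inclusion–exclusion

data Constraint (k : ℕ) : Set where
  decide distinct : Fin k → Fin k → Constraint k

merge : ∀ {k} → Fin k → Fin k → Fin k → Fin k
merge i j x = if does (x ≟ j) then i else x

-- The patterns whose counts occur when the constraints are eliminated one by one from
-- the number of maps φ = v ∘ ρ; ρ records the vertices identified so far.
patterns : ∀ {k} → (Fin k → Fin k) → Pattern k → List (Constraint k) → List (Pattern k)
patterns ρ L []                 = rename ρ L ∷ []
patterns ρ L (decide i j ∷ C)   = patterns ρ L C List.++ patterns ρ ((i , j) ∷ L) C
patterns ρ L (distinct i j ∷ C) = patterns ρ L C List.++ patterns (merge (ρ i) (ρ j) ∘ ρ) L C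

matches : Bool → Bool → Bool
matches true  b = b
matches false b = not b

-- τ prescribes the adjacencies; distinct i i holds vacuously.
satisfies : ∀ {n k} → Adj n → Adj k → (Fin k → Fin n) → Constraint k → Bool
satisfies A τ φ (decide i j)   = matches (τ i j) (A (φ i) (φ j))
satisfies A τ φ (distinct i j) = does (i ≟ j) ∨ not (does (φ i ≟ φ j))

module _ {n k} (A : Adj n) (τ : Adj k) where

  fits : Pattern k → List (Constraint k) → (Fin k → Fin n) → Bool
  fits L C φ = respects A φ L ∧ all (satisfies A τ φ) C

  fits-cong : ∀ L C {φ ψ} → (∀ x → φ x ≡ ψ x) → fits L C φ ≡ fits L C ψ
  fits-cong L C {φ} {ψ} φ≗ψ = cong₂ _∧_ (respects-cong A φ≗ψ L) (cong (List.foldr _∧_ true) (List.map-cong step C))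
    where
    step : ∀ c → satisfies A τ φ c ≡ satisfies A τ ψ c
    step (decide i j)   = cong (matches (τ i j)) (cong₂ A (φ≗ψ i) (φ≗ψ j))
    step (distinct i j) = cong (λ b → does (i ≟ j) ∨ not b) (cong₂ (λ x y → does (x ≟ y)) (φ≗ψ i) (φ≗ψ j))

  -- All vectors `v` are counted, not all maps `lookup v ∘ ρ`: a vertex outside the image of `ρ` is
  -- free and contributes a factor n.
  fitting : (Fin k → Fin k) → Pattern k → List (Constraint k) → ℕ
  fitting ρ L C = count (λ v → fits L C (lookup v ∘ ρ))

  opaque
    unfolding homs

    fitting-[] : ∀ ρ L → fitting ρ L [] ≡ homs A (rename ρ L)
    fitting-[] ρ L = ∑ⱽ-cong λ v → cong indicator
      (trans (∧-identityʳ _) (sym (respects-rename A (lookup v) ρ L)))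

  fitting-decide⁺ : ∀ ρ L i j C → τ i j ≡ true → fitting ρ L (decide i j ∷ C) ≡ fitting ρ ((i , j) ∷ L) C
  fitting-decide⁺ ρ L i j C τij rewrite τij = ∑ⱽ-cong {k} {n} λ v → cong indicator
    (swap (respects A (lookup v ∘ ρ) L) (A (lookup v (ρ i)) (lookup v (ρ j))) (all (satisfies A τ (lookup v ∘ ρ)) C))
    where
    swap : ∀ a b c → a ∧ b ∧ c ≡ (b ∧ a) ∧ c
    swap a b c = trans (sym (∧-assoc a b c)) (cong (_∧ c) (∧-comm a b))

  -- Maps without the edge and maps with it together make up the maps on which this pair is not
  -- constrained. The sum stands in for the subtraction of inclusion-exclusion.
  fitting-decide⁻ : ∀ ρ L i j C → τ i j ≡ false →
    fitting ρ L (decide i j ∷ C) + fitting ρ ((i , j) ∷ L) C ≡ fitting ρ L C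
  fitting-decide⁻ ρ L i j C τij rewrite τij =
    trans (sym (∑ⱽ-distrib-+ {k} {n} (λ v → indicator (respects A (lookup v ∘ ρ) L ∧ not (edge v) ∧ all (satisfies A τ (lookup v ∘ ρ)) C)) _))
          (∑ⱽ-cong λ v → split (respects A (lookup v ∘ ρ) L) (edge v) (all (satisfies A τ (lookup v ∘ ρ)) C))
    where
    edge : Vec (Fin n) k → Bool
    edge v = A (lookup v (ρ i)) (lookup v (ρ j))

    split : ∀ a b c → indicator (a ∧ not b ∧ c) + indicator ((b ∧ a) ∧ c) ≡ indicator (a ∧ c)
    split a     true  c rewrite ∧-zeroʳ a = refl
    split true  false c = +-identityʳ _
    split false false c = refl

  fitting-distinct-refl : ∀ ρ L i C → fitting ρ L (distinct i i ∷ C) ≡ fitting ρ L C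
  fitting-distinct-refl ρ L i C rewrite dec-true (i ≟ i) refl = refl

  fitting-distinct-merged : ∀ ρ L {i j} C → i ≢ j → ρ i ≡ ρ j → fitting ρ L (distinct i j ∷ C) ≡ 0
  fitting-distinct-merged ρ L {i} {j} C i≢j ρi≡ρj rewrite dec-false (i ≟ j) i≢j =
    trans (∑ⱽ-cong (λ v → cong indicator (none v))) (sym (*-distribˡ-∑ⱽ {k} {n} 0 (λ _ → 0)))
    where
    none : ∀ v → respects A (lookup v ∘ ρ) L ∧ not (does (lookup v (ρ i) ≟ lookup v (ρ j))) ∧ all (satisfies A τ (lookup v ∘ ρ)) C ≡ false
    none v rewrite dec-true (lookup v (ρ i) ≟ lookup v (ρ j)) (cong (lookup v) ρi≡ρj) = ∧-zeroʳ _

  -- Merging ρ j into ρ i leaves the value at ρ j free, which accounts for the factor n.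
  fitting-distinct : ∀ ρ L {i j} C → i ≢ j → ρ i ≢ ρ j →
    n * fitting ρ L (distinct i j ∷ C) + fitting (merge (ρ i) (ρ j) ∘ ρ) L C ≡ n * fitting ρ L C
  fitting-distinct ρ L {i} {j} C i≢j ρi≢ρj rewrite dec-false (i ≟ j) i≢j = begin
    n * ∑ⱽ (λ v → indicator (apart v)) + fitting (merge (ρ i) (ρ j) ∘ ρ) L C
      ≡⟨ cong (n * ∑ⱽ (λ v → indicator (apart v)) +_) merged ⟩
    n * ∑ⱽ (λ v → indicator (apart v)) + n * ∑ⱽ together
      ≡⟨ *-distribˡ-+ n (∑ⱽ (λ v → indicator (apart v))) (∑ⱽ together) ⟨
    n * (∑ⱽ (λ v → indicator (apart v)) + ∑ⱽ together)
      ≡⟨ cong (n *_) (∑ⱽ-distrib-+ (λ v → indicator (apart v)) together) ⟨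
    n * ∑ⱽ (λ v → indicator (apart v) + together v)
      ≡⟨ cong (n *_) (∑ⱽ-cong (λ v → split (respects A (lookup v ∘ ρ) L) (same v) _)) ⟩
    n * fitting ρ L C ∎
    where
    open ≡-Reasoning

    same : Vec (Fin n) k → Bool
    same v = does (lookup v (ρ i) ≟ lookup v (ρ j))

    apart : Vec (Fin n) k → Bool
    apart v = respects A (lookup v ∘ ρ) L ∧ not (same v) ∧ all (satisfies A τ (lookup v ∘ ρ)) C

    together : Vec (Fin n) k → ℕ
    together v = indicator (same v) * indicator (fits L C (lookup v ∘ ρ))

    split : ∀ a b c → indicator (a ∧ not b ∧ c) + indicator b * indicator (a ∧ c) ≡ indicator (a ∧ c)
    split a true  c rewrite ∧-zeroʳ a = +-identityʳ _
    split a false c = +-identityʳ _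

    lookup-merge : ∀ v x → lookup v (merge (ρ i) (ρ j) x) ≡ lookup (v [ ρ j ]≔ lookup v (ρ i)) x
    lookup-merge v x with x ≟ ρ j
    ... | yes refl = sym (Vec.lookup∘update (ρ j) v _)
    ... | no  x≢   = sym (Vec.lookup∘update′ x≢ v _)

    merged : fitting (merge (ρ i) (ρ j) ∘ ρ) L C ≡ n * ∑ⱽ together
    merged = begin
      fitting (merge (ρ i) (ρ j) ∘ ρ) L C
        ≡⟨ ∑ⱽ-cong (λ v → cong indicator (fits-cong L C (lookup-merge v ∘ ρ))) ⟩
      ∑ⱽ (λ v → indicator (fits L C (lookup (v [ ρ j ]≔ lookup v (ρ i)) ∘ ρ)))
        ≡⟨ ∑ⱽ-cong (λ v → sum-indicator (lookup v (ρ i)) (λ y → indicator (fits L C (lookup (v [ ρ j ]≔ y) ∘ ρ)))) ⟨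
      ∑ⱽ (λ v → sum (λ y → indicator (does (lookup v (ρ i) ≟ y)) * indicator (fits L C (lookup (v [ ρ j ]≔ y) ∘ ρ))))
        ≡⟨ ∑ⱽ-cong (λ v → sum-cong-≗ (λ y → cong₂ (λ a b → indicator (does (a ≟ b)) * indicator (fits L C (lookup (v [ ρ j ]≔ y) ∘ ρ)))
             (sym (Vec.lookup∘update′ ρi≢ρj v y)) (sym (Vec.lookup∘update (ρ j) v y)))) ⟩
      ∑ⱽ (λ v → sum (λ y → together (v [ ρ j ]≔ y)))
        ≡⟨ ∑ⱽ-update (ρ j) together ⟩
      n * ∑ⱽ together ∎

SameHoms : ∀ {n} → Adj n → Adj n → ∀ {k} → Pattern k → Set
SameHoms A B L = homs A L ≡ homs B L

-- The identities above express a count through counts with one constraint fewer, by the same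
-- formula for `A` and `B`. The order is a successor so that the factor coming from a merging can be
-- cancelled.
fitting-agree : ∀ {n k} (A B : Adj (suc n)) (τ : Adj k) ρ L C → All (SameHoms A B) (patterns ρ L C) →
                fitting A τ ρ L C ≡ fitting B τ ρ L C
fitting-agree A B τ ρ L [] (eq ∷ []) = trans (fitting-[] A τ ρ L) (trans eq (sym (fitting-[] B τ ρ L)))
fitting-agree A B τ ρ L (decide i j ∷ C) agree = cases (τ i j) refl
  where
  open ≡-Reasoning
  without = fitting-agree A B τ ρ L C (All.++⁻ˡ (patterns ρ L C) agree)
  with′   = fitting-agree A B τ ρ ((i , j) ∷ L) C (All.++⁻ʳ (patterns ρ L C) agree)

  cases : ∀ b → τ i j ≡ b → fitting A τ ρ L (decide i j ∷ C) ≡ fitting B τ ρ L (decide i j ∷ C)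
  cases true τij = begin
    fitting A τ ρ L (decide i j ∷ C)   ≡⟨ fitting-decide⁺ A τ ρ L i j C τij ⟩
    fitting A τ ρ ((i , j) ∷ L) C      ≡⟨ with′ ⟩
    fitting B τ ρ ((i , j) ∷ L) C      ≡⟨ fitting-decide⁺ B τ ρ L i j C τij ⟨
    fitting B τ ρ L (decide i j ∷ C)   ∎
  cases false τij = +-cancelʳ-≡ _ _ _ (begin
    fitting A τ ρ L (decide i j ∷ C) + fitting A τ ρ ((i , j) ∷ L) C  ≡⟨ fitting-decide⁻ A τ ρ L i j C τij ⟩
    fitting A τ ρ L C                                                 ≡⟨ without ⟩
    fitting B τ ρ L C                                                 ≡⟨ fitting-decide⁻ B τ ρ L i j C τij ⟨
    fitting B τ ρ L (decide i j ∷ C) + fitting B τ ρ ((i , j) ∷ L) C  ≡⟨ cong (fitting B τ ρ L (decide i j ∷ C) +_) with′ ⟨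
    fitting B τ ρ L (decide i j ∷ C) + fitting A τ ρ ((i , j) ∷ L) C  ∎)
fitting-agree {n} A B τ ρ L (distinct i j ∷ C) agree = cases (i ≟ j) (ρ i ≟ ρ j)
  where
  open ≡-Reasoning
  ρ′       = merge (ρ i) (ρ j) ∘ ρ
  unmerged = fitting-agree A B τ ρ L C (All.++⁻ˡ (patterns ρ L C) agree)
  merged   = fitting-agree A B τ ρ′ L C (All.++⁻ʳ (patterns ρ L C) agree)

  cases : Dec (i ≡ j) → Dec (ρ i ≡ ρ j) →
          fitting A τ ρ L (distinct i j ∷ C) ≡ fitting B τ ρ L (distinct i j ∷ C)
  cases (yes refl) _ = begin
    fitting A τ ρ L (distinct i i ∷ C)  ≡⟨ fitting-distinct-refl A τ ρ L i C ⟩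
    fitting A τ ρ L C                   ≡⟨ unmerged ⟩
    fitting B τ ρ L C                   ≡⟨ fitting-distinct-refl B τ ρ L i C ⟨
    fitting B τ ρ L (distinct i i ∷ C)  ∎
  cases (no i≢j) (yes ρi≡ρj) =
    trans (fitting-distinct-merged A τ ρ L C i≢j ρi≡ρj) (sym (fitting-distinct-merged B τ ρ L C i≢j ρi≡ρj))
  cases (no i≢j) (no ρi≢ρj) = *-cancelˡ-≡ _ _ (suc n) (+-cancelʳ-≡ _ _ _ (begin
    suc n * fitting A τ ρ L (distinct i j ∷ C) + fitting A τ ρ′ L C  ≡⟨ fitting-distinct A τ ρ L C i≢j ρi≢ρj ⟩
    suc n * fitting A τ ρ L C                                        ≡⟨ cong (suc n *_) unmerged ⟩
    suc n * fitting B τ ρ L C                                        ≡⟨ fitting-distinct B τ ρ L C i≢j ρi≢ρj ⟨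
    suc n * fitting B τ ρ L (distinct i j ∷ C) + fitting B τ ρ′ L C  ≡⟨ cong (suc n * fitting B τ ρ L (distinct i j ∷ C) +_) merged ⟨
    suc n * fitting B τ ρ L (distinct i j ∷ C) + fitting A τ ρ′ L C  ∎))

-- Coloured patterns and cancellation

pairs : ∀ n → List (Fin n × Fin n)
pairs n = cartesianProduct (allFin n) (allFin n)

∈-pairs : ∀ {n} (u v : Fin n) → (u , v) ∈ pairs n
∈-pairs u v = ∈-cartesianProduct⁺ (∈-allFin u) (∈-allFin v)

module _ {q} (K : Pattern q) (n : ℕ) where

  adjacency : Fin q × Fin q → Fin n × Fin n → Constraint (q * n)
  adjacency (c , d) (u , v) = decide (combine c u) (combine d v)

  injectivity : Fin q → Fin n × Fin n → Constraint (q * n)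
  injectivity c (u , v) = distinct (combine c u) (combine c v)

  -- The fibre over a vertex `c` of `K` consists of the vertices `combine c u`. Adjacency is
  -- prescribed only between fibres over an edge of `K` and distinctness only within a fibre, so
  -- elimination yields only edges and mergings compatible with the colours.
  constraints : List (Constraint (q * n))
  constraints = cartesianProductWith adjacency K (pairs n)
         List.++ cartesianProductWith injectivity (allFin q) (pairs n)

  adjacency∈ : ∀ {c d} → (c , d) ∈ K → ∀ u v → decide (combine c u) (combine d v) ∈ constraints
  adjacency∈ cd∈K u v = ∈-++⁺ˡ (∈-cartesianProductWith⁺ adjacency cd∈K (∈-pairs u v))

  injectivity∈ : ∀ c u v → distinct (combine c u) (combine c v) ∈ constraints
  injectivity∈ c u v = ∈-++⁺ʳ (cartesianProductWith adjacency K (pairs n))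
    (∈-cartesianProductWith⁺ injectivity (∈-allFin c) (∈-pairs u v))

  All-constraints : ∀ {P : Constraint (q * n) → Set} →
    (∀ {c d} → (c , d) ∈ K → ∀ u v → P (decide (combine c u) (combine d v))) →
    (∀ c u v → P (distinct (combine c u) (combine c v))) → All P constraints
  All-constraints adj inj = All.++⁺
    (All.cartesianProductWith⁺ (setoid _) (setoid _) adjacency K (pairs n) (λ {_} {(u , v)} cd∈K _ → adj cd∈K u v))
    (All.cartesianProductWith⁺ (setoid _) (setoid _) injectivity (allFin q) (pairs n) (λ {c} {(u , v)} _ _ → inj c u v))

  family : List (Pattern (q * n))
  family = patterns id [] constraints

  colour : Fin (q * n) → Fin q
  colour x = proj₁ (remQuot n x)

  vertex : Fin (q * n) → Fin n
  vertex x = proj₂ (remQuot {q} n x)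

  colour-combine : ∀ c u → colour (combine c u) ≡ c
  colour-combine c u = cong proj₁ (remQuot-combine c u)

  vertex-combine : ∀ c u → vertex (combine c u) ≡ u
  vertex-combine c u = cong proj₂ (remQuot-combine {q} c u)

-- This says that `κ` is a homomorphism from the pattern to `K`.
Coloured : ∀ {k q} → Pattern q → (Fin k → Fin q) → Pattern k → Set
Coloured K κ = All (λ (x , y) → (κ x , κ y) ∈ K)

Respectful : ∀ {k q} → Pattern q → (Fin k → Fin q) → Constraint k → Set
Respectful K κ (decide i j)   = (κ i , κ j) ∈ K
Respectful K κ (distinct i j) = κ i ≡ κ j

merge-colour : ∀ {k q} (κ : Fin k → Fin q) {i j} → κ i ≡ κ j → ∀ x → κ (merge i j x) ≡ κ x
merge-colour κ {j = j} eq x with x ≟ j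
... | yes refl = eq
... | no _     = refl

-- Every added edge lies over an edge of `K`, and merging identifies only vertices of one colour, so
-- `κ ∘ ρ` keeps agreeing with `κ`.
patterns-coloured : ∀ {k q} {K : Pattern q} {κ : Fin k → Fin q} {ρ L C} →
  (∀ x → κ (ρ x) ≡ κ x) → Coloured K κ L → All (Respectful K κ) C →
  All (Coloured K κ) (patterns ρ L C)
patterns-coloured {K = K} {κ} {ρ} {L} {[]} κρ col [] =
  All.map⁺ (All.map (λ {(x , y)} → subst (_∈ K) (sym (cong₂ _,_ (κρ x) (κρ y)))) col) ∷ []
patterns-coloured {C = decide i j ∷ C} κρ col (r ∷ rs) =
  All.++⁺ (patterns-coloured κρ col rs) (patterns-coloured κρ (r ∷ col) rs)
patterns-coloured {κ = κ} {ρ} {C = distinct i j ∷ C} κρ col (r ∷ rs) =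
  All.++⁺ (patterns-coloured κρ col rs)
          (patterns-coloured (λ x → trans (merge-colour κ (trans (κρ i) (trans r (sym (κρ j)))) (ρ x)) (κρ x)) col rs)

family-coloured : ∀ {q} (K : Pattern q) n → All (Coloured K (colour K n)) (family K n)
family-coloured K n = patterns-coloured (λ _ → refl) []
  (All-constraints K n
    (λ {c} {d} cd∈K u v → subst (_∈ K) (sym (cong₂ _,_ (colour-combine K n c u) (colour-combine K n d v))) cd∈K)
    (λ c u v → trans (colour-combine K n c u) (sym (colour-combine K n c v))))

matches-refl : ∀ b → T (matches b b)
matches-refl true  = tt
matches-refl false = tt

matches⁻ : ∀ a b → T (matches a b) → a ≡ b
matches⁻ true  true  _ = refl
matches⁻ false false _ = refl

implication⁺ : ∀ {P Q : Set} (P? : Dec P) (Q? : Dec Q) → (Q → P) → T (does P? ∨ not (does Q?))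
implication⁺ (yes _) _       _ = tt
implication⁺ (no _)  (no _)  _ = tt
implication⁺ (no ¬p) (yes q) f = ¬p (f q)

implication⁻ : ∀ {P Q : Set} (P? : Dec P) (Q? : Dec Q) → T (does P? ∨ not (does Q?)) → Q → P
implication⁻ (yes p) _       _ _ = p
implication⁻ (no _)  (no ¬q) _ q = contradiction q ¬q

-- Two graphs that agree on the family of K have products with K that are isomorphic
-- over K; ψ c is the isomorphism on the fibre over c.
family-determines : ∀ {n q} (A B : Adj (suc n)) (K : Pattern q) → All (SameHoms A B) (family K (suc n)) →
  ∃ λ (ψ : Fin q → Fin (suc n) → Fin (suc n)) →
    (∀ {c d} → (c , d) ∈ K → ∀ u v → A u v ≡ B (ψ c u) (ψ d v)) ×
    (∀ c → Injective _≡_ _≡_ (ψ c))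
family-determines {n′} {q} A B K agree =
  let v , fitsB = count>0⇒∃ (λ v → fits B τ [] (constraints K n) (lookup v)) fittingB>0
  in ψ v fitsB , ψ-adj v fitsB , ψ-inj v fitsB
  where
  n = suc n′

  -- The prescribed adjacencies are those of `A` itself, so the projection `vertex` is a solution in
  -- `A`. As `B` has equally many solutions, it has one too.
  τ : Adj (q * n)
  τ x y = A (vertex K n x) (vertex K n y)

  satisfiedA : All (T ∘ satisfies A τ (vertex K n)) (constraints K n)
  satisfiedA = All-constraints K n (λ {c} {d} _ u v → matches-refl (τ (combine c u) (combine d v))) distinct⁺
    where
    distinct⁺ : ∀ c u v → T (satisfies A τ (vertex K n) (distinct (combine c u) (combine c v)))
    distinct⁺ c u v = implication⁺ (combine c u ≟ combine c v) (vertex K n (combine c u) ≟ vertex K n (combine c v))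
      (λ eq → cong (combine c) (trans (sym (vertex-combine K n c u)) (trans eq (vertex-combine K n c v))))

  fittingB>0 : fitting B τ id [] (constraints K n) > 0
  fittingB>0 = subst (_> 0) (fitting-agree A B τ id [] (constraints K n) agree)
    (∃⇒count>0 (λ v → fits A τ [] (constraints K n) (lookup v)) (Vec.tabulate (vertex K n))
      (subst T (fits-cong A τ [] (constraints K n) (λ x → sym (Vec.lookup∘tabulate (vertex K n) x)))
        (All.all⁻ (satisfies A τ (vertex K n)) satisfiedA)))

  module _ (v : Vec (Fin n) (q * n)) (fitsB : T (fits B τ [] (constraints K n) (lookup v))) where

    satisfiedB : All (T ∘ satisfies B τ (lookup v)) (constraints K n)
    satisfiedB = All.all⁺ (satisfies B τ (lookup v)) (constraints K n) fitsB

    ψ : Fin q → Fin n → Fin n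
    ψ c u = lookup v (combine c u)

    ψ-adj : ∀ {c d} → (c , d) ∈ K → ∀ u w → A u w ≡ B (ψ c u) (ψ d w)
    ψ-adj {c} {d} cd∈K u w =
      trans (sym (cong₂ A (vertex-combine K n c u) (vertex-combine K n d w)))
            (matches⁻ _ _ (All.lookup satisfiedB (adjacency∈ K n cd∈K u w)))

    ψ-inj : ∀ c → Injective _≡_ _≡_ (ψ c)
    ψ-inj c {u} {w} eq = combine-injectiveʳ c u c w
      (implication⁻ (combine c u ≟ combine c w) (ψ c u ≟ ψ c w) (All.lookup satisfiedB (injectivity∈ K n c u w)) eq)

-- A missed value could be punched out of the codomain, leaving an injection into a smaller set.
injective⇒surjective : ∀ {n} {f : Fin n → Fin n} → Injective _≡_ _≡_ f → ∀ y → ∃ λ x → f x ≡ y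
injective⇒surjective {suc n} {f} inj y with any? (λ x → f x ≟ y)
... | yes found = found
... | no  ¬found = contradiction (injective⇒≤ {f = λ x → punchOut (y≢f x)} (λ eq → inj (punchOut-injective (y≢f _) (y≢f _) eq))) 1+n≰n
  where
  y≢f : ∀ x → y ≢ f x
  y≢f x y≡fx = ¬found (x , sym y≡fx)

data Walk {X : Set} (R : X → X → Set) : ℕ → X → X → Set where
  []  : ∀ {x} → Walk R 0 x x
  _∷_ : ∀ {l x y z} → R x y → Walk R l y z → Walk R (suc l) x z

Edge : ∀ {k} → Pattern k → Fin k → Fin k → Set
Edge L u v = (u , v) ∈ L ⊎ (v , u) ∈ L

Edge-sym : ∀ {k} {L : Pattern k} {u v} → Edge L u v → Edge L v u
Edge-sym = Sum.swap

odd : ℕ → Bool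
odd zero    = false
odd (suc l) = not (odd l)

module _ {n q} {A B : Adj n} (symA : Symmetric A) (symB : Symmetric B) {K : Pattern q}
         (ψ : Fin q → Fin n → Fin n) (ψ-inj : ∀ c → Injective _≡_ _≡_ (ψ c))
         (ψ-adj : ∀ {c d} → (c , d) ∈ K → ∀ u v → A u v ≡ B (ψ c u) (ψ d v)) where

  private
    open ≡-Reasoning

    ψ-edge : ∀ {c d} → Edge K c d → ∀ u v → A u v ≡ B (ψ c u) (ψ d v)
    ψ-edge (inj₁ cd∈K) u v = ψ-adj cd∈K u v
    ψ-edge (inj₂ dc∈K) u v = trans (symA u v) (trans (ψ-adj dc∈K v u) (symB _ _))

  mutual
    -- With e the second vertex of the walk, write z as `ψ e v`. The first edge pulls the adjacency
    -- back to `A u v`; the rest of the walk is odd and pushes it forward to the fibre over d.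
    even-walk⇒twins : ∀ {l c d} → odd l ≡ false → Walk (Edge K) l c d → ∀ u z → B (ψ c u) z ≡ B (ψ d u) z
    even-walk⇒twins _ [] u z = refl
    even-walk⇒twins {suc l} {c} {d} even (_∷_ {y = e} ce w) u z with v , refl ← injective⇒surjective (ψ-inj e) z = begin
      B (ψ c u) (ψ e v)  ≡⟨ ψ-edge ce u v ⟨
      A u v              ≡⟨ symA u v ⟩
      A v u              ≡⟨ odd-walk⇒adjacency (not-false even) w v u ⟩
      B (ψ e v) (ψ d u)  ≡⟨ symB _ _ ⟩
      B (ψ d u) (ψ e v)  ∎
      where
      not-false : ∀ {b} → not b ≡ false → b ≡ true
      not-false {true} _ = refl

    -- The first edge leads to `B (ψ c u) (ψ e v)`; the rest of the walk is even, so `ψ e v` and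
    -- `ψ d v` have the same neighbours.
    odd-walk⇒adjacency : ∀ {l c d} → odd l ≡ true → Walk (Edge K) l c d → ∀ u v → A u v ≡ B (ψ c u) (ψ d v)
    odd-walk⇒adjacency {suc l} {c} {d} odd (_∷_ {y = e} ce w) u v = begin
      A u v              ≡⟨ ψ-edge ce u v ⟩
      B (ψ c u) (ψ e v)  ≡⟨ symB _ _ ⟩
      B (ψ e v) (ψ c u)  ≡⟨ even-walk⇒twins (not-true odd) w v (ψ c u) ⟩
      B (ψ d v) (ψ c u)  ≡⟨ symB _ _ ⟩
      B (ψ c u) (ψ d v)  ∎
      where
      not-true : ∀ {b} → not b ≡ true → b ≡ false
      not-true {false} _ = refl

-- As both graphs have order n, this amounts to an isomorphism: an injection of a finite set into
-- itself is onto.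
Embeds : ∀ {n} → Adj n → Adj n → Set
Embeds {n} A B = ∃ λ (ψ : Fin n → Fin n) → Injective _≡_ _≡_ ψ × (∀ u v → A u v ≡ B (ψ u) (ψ v))

family-separates : ∀ {n q l c} {A B : Adj (suc n)} → Symmetric A → Symmetric B → (K : Pattern q) →
  odd l ≡ true → Walk (Edge K) l c c → All (SameHoms A B) (family K (suc n)) →
  Embeds A B
family-separates {c = c} {A} {B} symA symB K odd walk agree =
  let ψ , ψ-adj , ψ-inj = family-determines A B K agree
  in ψ c , ψ-inj c , odd-walk⇒adjacency symA symB ψ ψ-inj ψ-adj odd walk

-- Bipartite patterns and odd cycles

mapWalk : ∀ {X Y : Set} {R : X → X → Set} {S : Y → Y → Set} (f : X → Y) →
          (∀ {x y} → R x y → S (f x) (f y)) → ∀ {l x y} → Walk R l x y → Walk S l (f x) (f y)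
mapWalk f g []      = []
mapWalk f g (r ∷ w) = g r ∷ mapWalk f g w

_++ʷ_ : ∀ {X : Set} {R : X → X → Set} {l m x y z} → Walk R l x y → Walk R m y z → Walk R (l + m) x z
[]      ++ʷ w′ = w′
(r ∷ w) ++ʷ w′ = r ∷ (w ++ʷ w′)

odd-+ : ∀ l m → odd (l + m) ≡ odd l xor odd m
odd-+ zero    m = refl
odd-+ (suc l) m = trans (cong not (odd-+ l m)) (not-xor (odd l) (odd m))
  where
  not-xor : ∀ a b → not (a xor b) ≡ not a xor b
  not-xor true  b = not-involutive b
  not-xor false b = refl

WalkOfParity : ∀ {k} → Pattern k → Bool → Fin k → Fin k → Set
WalkOfParity L b u v = ∃ λ l → odd l ≡ b × Walk (Edge L) l u v

TwoColouring : ∀ {k} → Pattern k → (Fin k → Bool) → Set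
TwoColouring L χ = All (λ (u , v) → χ u ≡ not (χ v)) L

-- `comp` labels the connected components. The field `walk` makes the sides determine a parity of
-- connection; it supplies an odd closed walk as soon as a further edge joins equal sides of one
-- component.
record Bipartition {k} (L : Pattern k) : Set where
  field
    comp      : Fin k → Fin k
    side      : Fin k → Bool
    comp-edge : All (λ (u , v) → comp u ≡ comp v) L
    side-edge : TwoColouring L side
    walk      : ∀ u v → comp u ≡ comp v → WalkOfParity L (side u xor side v) u v

Edge-there : ∀ {k} {L : Pattern k} {e u v} → Edge L u v → Edge (e ∷ L) u v
Edge-there = Sum.map there there

weaken : ∀ {k} {L : Pattern k} {e b u v} → WalkOfParity L b u v → WalkOfParity (e ∷ L) b u v
weaken (l , o , w) = l , o , mapWalk id Edge-there w

-- Adding an edge between two components flips one side of the 2-colouring if necessary.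
module Join {k} {L : Pattern k} (P : Bipartition L) (a b : Fin k)
            (apart : Bipartition.comp P a ≢ Bipartition.comp P b) where

  open Bipartition P

  -- Chosen so that `side a xor flip` equals `not (side b)`; it is applied to the whole component of
  -- `a`.
  flip : Bool
  flip = side a xor not (side b)

  inA : Fin k → Bool
  inA x = does (comp x ≟ comp a)

  comp′ : Fin k → Fin k
  comp′ x = if inA x then comp b else comp x

  side′ : Fin k → Bool
  side′ x = if inA x then side x xor flip else side x

  a-in : inA a ≡ true
  a-in = dec-true (comp a ≟ comp a) refl

  b-out : inA b ≡ false
  b-out = dec-false (comp b ≟ comp a) (apart ∘ sym)

  inA-cong : ∀ {u v} → comp u ≡ comp v → inA u ≡ inA v
  inA-cong eq = cong (λ c → does (c ≟ comp a)) eq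

  comp-edge′ : All (λ (u , v) → comp′ u ≡ comp′ v) ((a , b) ∷ L)
  comp-edge′ = new ∷ All.map (λ eq → cong₂ (λ i c → if i then comp b else c) (inA-cong eq) eq) comp-edge
    where
    new : comp′ a ≡ comp′ b
    new rewrite a-in | b-out = refl

  side-edge′ : TwoColouring ((a , b) ∷ L) side′
  side-edge′ = new ∷ All.zipWith (λ (eq , opp) → old (inA-cong eq) opp) (comp-edge , side-edge)
    where
    cancel : ∀ x y → x xor (x xor not y) ≡ not y
    cancel true  y = not-involutive (not y)
    cancel false y = refl

    new : side′ a ≡ not (side′ b)
    new rewrite a-in | b-out = cancel (side a) (side b)

    old : ∀ {u v} → inA u ≡ inA v → side u ≡ not (side v) → side′ u ≡ not (side′ v)
    old {u} {v} eq opp rewrite eq | opp with inA v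
    ... | false = refl
    ... | true  with side v
    ...   | true  = sym (not-involutive flip)
    ...   | false = refl

  walk′ : ∀ u v → comp′ u ≡ comp′ v → WalkOfParity ((a , b) ∷ L) (side′ u xor side′ v) u v
  walk′ u v eq with comp u ≟ comp a | comp v ≟ comp a
  ... | yes ua | yes va = subst (λ p → WalkOfParity _ p u v) (both (side u) (side v) flip) (weaken (walk u v (trans ua (sym va))))
    where
    both : ∀ x y f → x xor y ≡ (x xor f) xor (y xor f)
    both = solve 3 (λ x y f → x :+ y := (x :+ f) :+ (y :+ f)) refl
  ... | no _ | no _ = weaken (walk u v eq)
  -- Here `v` lies in the component of `b`, so the walk goes from `u` to `a`, across the new edge,
  -- and from `b` to `v`.
  ... | yes ua | no _ =
    let l , ol , w  = walk u a ua
        m , om , w′ = walk b v eq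
    in l + suc m , trans (odd-+ l (suc m)) (trans (cong₂ (λ x y → x xor not y) ol om) (through (side u) (side a) (side b) (side v)))
     , (mapWalk id Edge-there w ++ʷ (inj₁ (here refl) ∷ mapWalk id Edge-there w′))
    where
    through : ∀ u a b v → (u xor a) xor not (b xor v) ≡ (u xor (a xor not b)) xor v
    through = solve 4 (λ u a b v → (u :+ a) :+ (con true :+ (b :+ v)) := (u :+ (a :+ (con true :+ b))) :+ v) refl
  ... | no _ | yes va =
    let l , ol , w  = walk u b eq
        m , om , w′ = walk a v (sym va)
    in l + suc m , trans (odd-+ l (suc m)) (trans (cong₂ (λ x y → x xor not y) ol om) (through (side u) (side b) (side a) (side v)))
     , (mapWalk id Edge-there w ++ʷ (inj₂ (here refl) ∷ mapWalk id Edge-there w′))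
    where
    through : ∀ u b a v → (u xor b) xor not (a xor v) ≡ u xor (v xor (a xor not b))
    through = solve 4 (λ u b a v → (u :+ b) :+ (con true :+ (a :+ v)) := u :+ (v :+ (a :+ (con true :+ b)))) refl

  joined : Bipartition ((a , b) ∷ L)
  joined = record { comp = comp′ ; side = side′ ; comp-edge = comp-edge′ ; side-edge = side-edge′ ; walk = walk′ }

bipartition-or-odd-closed-walk : ∀ {k} (L : Pattern k) → Bipartition L ⊎ ∃ λ u → WalkOfParity L true u u
bipartition-or-odd-closed-walk [] = inj₁ (record
  { comp = id ; side = λ _ → false ; comp-edge = [] ; side-edge = [] ; walk = λ { u .u refl → 0 , refl , [] } })
bipartition-or-odd-closed-walk ((a , b) ∷ L) with bipartition-or-odd-closed-walk L
... | inj₂ (u , w) = inj₂ (u , weaken w)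
... | inj₁ P with Bipartition.comp P a ≟ Bipartition.comp P b
...   | no  apart = inj₁ (Join.joined P a b apart)
...   | yes comp≡ with Bipartition.side P a Bool.≟ not (Bipartition.side P b)
...     | yes opposite = inj₁ (record
            { comp = comp ; side = side ; comp-edge = comp≡ ∷ comp-edge ; side-edge = opposite ∷ side-edge
            ; walk = λ u v eq → weaken (walk u v eq) })
  where open Bipartition P
...     | no ¬opposite =
  -- The sides of `a` and `b` are equal, so this walk is even, and the new edge closes it to an odd
  -- one based at `b`.
  let l , ol , w = walk a b comp≡
  in inj₂ (b , suc l , cong not (trans ol (equal ¬opposite)) , inj₂ (here refl) ∷ mapWalk id Edge-there w)
  where
  open Bipartition P
  equal : ∀ {x y} → x ≢ not y → x xor y ≡ false
  equal {true}  {true}  _ = refl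
  equal {true}  {false} h = contradiction refl h
  equal {false} {true}  h = contradiction refl h
  equal {false} {false} _ = refl

OddClosedWalk : ∀ {k} → Pattern k → ℕ → Set
OddClosedWalk L j = ∃ λ u → Walk (Edge L) (suc (j * 2)) u u

odd⇒suc-double : ∀ l → odd l ≡ true → ∃ λ j → l ≡ suc (j * 2)
odd⇒suc-double (suc zero)    _ = 0 , refl
odd⇒suc-double (suc (suc l)) h with j , refl ← odd⇒suc-double l (trans (sym (not-involutive (odd l))) h) = suc j , refl

odd-suc-double : ∀ j → odd (suc (j * 2)) ≡ true
odd-suc-double zero    = refl
odd-suc-double (suc j) = trans (not-involutive _) (odd-suc-double j)

-- The first edge is traversed back and forth once for every unit of `d`.
OddClosedWalk-+ : ∀ {k} {L : Pattern k} d {j} → OddClosedWalk L j → OddClosedWalk L (d + j)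
OddClosedWalk-+ zero    w = w
OddClosedWalk-+ (suc d) w with u , e ∷ w′ ← OddClosedWalk-+ d w = u , e ∷ Edge-sym e ∷ e ∷ w′

-- `Bs` collects the bipartite members. Padding gives the odd closed walks in all the others a
-- common length, so that one odd cycle maps to each of them.
bipartite-members : ∀ {k} (Ls : List (Pattern k)) → ∃₂ λ j Bs →
  All (∃ ∘ TwoColouring) Bs × All (λ L → L ∈ Bs ⊎ OddClosedWalk L j) Ls
bipartite-members [] = 0 , [] , [] , []
bipartite-members (L ∷ Ls) with j , Bs , two , rest ← bipartite-members Ls | bipartition-or-odd-closed-walk L
... | inj₁ P = j , L ∷ Bs , (-, Bipartition.side-edge P) ∷ two , inj₁ (here refl) ∷ All.map (Sum.map₁ there) rest
... | inj₂ (u , l , odd , w) with i , refl ← odd⇒suc-double l odd =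
  j + i , Bs , two , inj₂ (OddClosedWalk-+ j (u , w)) ∷
  All.map (Sum.map₂ (subst (OddClosedWalk _) (+-comm i j) ∘ OddClosedWalk-+ i)) rest

-- There are `suc l` edges, so the cycle is odd for even `l`; `cycle 0` is a loop.
cycle : ∀ l → Pattern (suc l)
cycle l = (fromℕ l , zero) ∷ List.map (λ i → inject₁ i , suc i) (allFin l)

cycle-loopless : ∀ l → Loopless (cycle (suc l))
cycle-loopless l = (λ ()) ∷ All.map⁺ (All.tabulate (λ {i} _ → inject₁≢suc i))
  where
  inject₁≢suc : ∀ {l} (i : Fin l) → inject₁ i ≢ suc i
  inject₁≢suc (suc i) eq = inject₁≢suc i (suc-injective eq)

module _ {X : Set} {R : X → X → Set} where

  visit : ∀ {l x y} → Walk R l x y → Fin (suc l) → X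
  visit {x = x} _       zero    = x
  visit         (_ ∷ w) (suc i) = visit w i

  visit-last : ∀ {l x y} (w : Walk R l x y) → visit w (fromℕ l) ≡ y
  visit-last []      = refl
  visit-last (_ ∷ w) = visit-last w

  visit-step : ∀ {l x y} (w : Walk R l x y) i → R (visit w (inject₁ i)) (visit w (suc i))
  visit-step (r ∷ [])       zero    = r
  visit-step (r ∷ _ ∷ _)    zero    = r
  visit-step (_ ∷ w)        (suc i) = visit-step w i

  closed-walk⇒cycle : ∀ {l x} → Walk R (suc l) x x →
                      ∃ λ (f : Fin (suc l) → X) → All (λ (i , j) → R (f i) (f j)) (cycle l)
  -- The first step `r` becomes the closing edge of the cycle, and the tail `w` its path.
  closed-walk⇒cycle (r ∷ w) = visit w ,
    subst (λ z → R z _) (sym (visit-last w)) r ∷ All.map⁺ (All.tabulate (λ {i} _ → visit-step w i))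

cycle-walk : ∀ l → Walk (Edge (cycle l)) (suc l) (fromℕ l) (fromℕ l)
cycle-walk l = inj₁ (here refl) ∷ mapWalk id (λ { (step i) → inj₁ (there (∈-map⁺ _ (∈-allFin i))) }) (path l)
  where
  data Step {l} : Fin (suc l) → Fin (suc l) → Set where
    step : (i : Fin l) → Step (inject₁ i) (suc i)

  path : ∀ l → Walk (Step {l}) l zero (fromℕ l)
  path zero    = []
  path (suc l) = step zero ∷ mapWalk suc (λ { (step i) → step (suc i) }) (path l)

-- A homomorphism from `K` to `A` is composed with the colouring.
coloured-homs>0 : ∀ {n k q} {A : Adj n} {K : Pattern q} {κ : Fin k → Fin q} {L} →
                  Coloured K κ L → homs A K > 0 → homs A L > 0
coloured-homs>0 {A = A} {K} {κ} {L} col pos with φ , h ← homs>0⁻ A {L = K} pos =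
  homs>0⁺ A {L = L} (φ ∘ κ) (All.map (All.lookup h) col)

coloured-loopless : ∀ {k q} {K : Pattern q} {κ : Fin k → Fin q} {L} → Loopless K → Coloured K κ L → Loopless L
coloured-loopless {κ = κ} loopless = All.map (λ e∈K u≡v → All.lookup loopless e∈K (cong κ u≡v))

closed-walk-homs>0 : ∀ {n k l u} {A : Adj n} → Symmetric A → {L : Pattern k} →
                     Walk (Edge L) (suc l) u u → homs A L > 0 → homs A (cycle l) > 0
closed-walk-homs>0 {l = l} {A = A} symA {L} w pos
  with φ , h ← homs>0⁻ A {L = L} pos | f , g ← closed-walk⇒cycle w
  = homs>0⁺ A {L = cycle l} (φ ∘ f) (All.map edge g)
  where
  edge : ∀ {u v} → Edge L u v → T (A (φ u) (φ v))
  edge (inj₁ uv∈L) = All.lookup h uv∈L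
  edge (inj₂ vu∈L) = subst T (symA _ _) (All.lookup h vu∈L)

K₂ : Pattern 2
K₂ = (zero , suc zero) ∷ []

two-coloured-loopless : ∀ {k} {L : Pattern k} {χ} → TwoColouring L χ → Loopless L
two-coloured-loopless = All.map λ { {u , _} opp refl → not-fixed opp }
  where
  not-fixed : ∀ {b} → b ≢ not b
  not-fixed {true}  ()
  not-fixed {false} ()

-- One colour class collapses to `a` and the other to `b`.
two-coloured-homs>0 : ∀ {n k} {A : Adj n} → Symmetric A → {L : Pattern k} {χ : Fin k → Bool} →
                      TwoColouring L χ → ∀ {a b} → T (A a b) → homs A L > 0
two-coloured-homs>0 {A = A} symA {L} {χ} two {a} {b} ab =
  homs>0⁺ A {L = L} (λ x → if χ x then a else b) (All.map (λ {(u , v)} → edge (χ u) (χ v)) two)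
  where
  edge : ∀ x y → x ≡ not y → T (A (if x then a else b) (if y then a else b))
  edge true  false _ = ab
  edge false true  _ = subst T (symA a b) ab

isomorphism : ∀ {n} {A B : Adj n} → Embeds A B →
              Σ (Fin n ↔ Fin n) λ φ → ∀ u v → A u v ≡ B (Inverse.to φ u) (Inverse.to φ v)
isomorphism (ψ , inj , adj) = mk↔ₛ′ ψ (proj₁ ∘ surj) (proj₂ ∘ surj) (λ x → inj (proj₂ (surj (ψ x)))) , adj
  where surj = injective⇒surjective inj

≯0⇒≡0 : ∀ {m} → ¬ m > 0 → m ≡ 0
≯0⇒≡0 = n≤0⇒n≡0 ∘ ≮⇒≥

-- The two patterns for a given order, and the case distinction.

private
  module Construction (n′ : ℕ) where
    n = suc n′

    loop : Pattern 1
    loop = (zero , zero) ∷ []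

    members = bipartite-members (family loop n)

    j  = proj₁ members
    Bs = proj₁ (proj₂ members)

    two-coloured : All (∃ ∘ TwoColouring) Bs
    two-coloured = proj₁ (proj₂ (proj₂ members))

    covered : All (λ L → L ∈ Bs ⊎ OddClosedWalk L j) (family loop n)
    covered = proj₂ (proj₂ (proj₂ members))

    -- The length is 2j + 3 rather than 2j + 1, since for j = 0 the latter would give a loop.
    C : Pattern (suc (suc j * 2))
    C = cycle (suc j * 2)

    Ls₁ Ls₂ : List (∃ Pattern)
    Ls₁ = (-, C) ∷ List.map -,_ (family C n)
    Ls₂ = (-, K₂) ∷ List.map -,_ Bs

    F₁ = proj₂ (bundle n Ls₁)
    F₂ = proj₂ (bundle n Ls₂)

    loopless₁ : Loopless F₁
    loopless₁ = bundle-loopless {Ls = Ls₁} (C-loopless ∷ All.map⁺ (All.map (coloured-loopless C-loopless) (family-coloured C n)))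
      where C-loopless = cycle-loopless (suc (j * 2))

    loopless₂ : Loopless F₂
    loopless₂ = bundle-loopless {Ls = Ls₂} (((λ ()) ∷ []) ∷ All.map⁺ (All.map (two-coloured-loopless ∘ proj₂) two-coloured))

    module _ {A B : Adj n} (symA : Symmetric A) (symB : Symmetric B) where

      embeds₁ : homs A F₁ > 0 → homs A F₁ ≡ homs B F₁ → Embeds A B
      embeds₁ pos eq = family-separates symA symB C (odd-suc-double (suc j)) (cycle-walk (suc j * 2))
        (All.map⁻ (All.tail (bundle-injective A B {Ls₁} pos eq)))

      embeds₂ : homs A C ≡ 0 → homs B C ≡ 0 → homs A F₂ > 0 → homs A F₂ ≡ homs B F₂ → Embeds A B
      embeds₂ noA noB pos eq = family-separates {l = 1} symA symB loop refl (inj₁ (here refl) ∷ [])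
        (All.map agree covered)
        where
        agreeBs = All.map⁻ (All.tail (bundle-injective A B {Ls₂} pos eq))

        none : ∀ {X : Adj n} → Symmetric X → homs X C ≡ 0 → ∀ {L : Pattern (1 * n)} → OddClosedWalk L j → homs X L ≡ 0
        -- One more detour lengthens the walk from 2j + 1 to 2j + 3, the length of `C`.
        none symX noC w = ≯0⇒≡0 λ pos → >⇒≢ (closed-walk-homs>0 symX (proj₂ (OddClosedWalk-+ 1 {j} w)) pos) noC

        agree : ∀ {L} → L ∈ Bs ⊎ OddClosedWalk L j → SameHoms A B L
        agree (inj₁ L∈Bs) = All.lookup agreeBs L∈Bs
        agree (inj₂ w)    = trans (none symA noA w) (sym (none symB noB w))

    -- All members of `Ls₁` map to `C`, so a homomorphism from `C` to `A` would make every factor of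
    -- the count of `F₁` positive.
    C-count : ∀ (A : Adj n) → homs A F₁ ≡ 0 → homs A C ≡ 0
    C-count A zero₁ = ≯0⇒≡0 λ C>0 → >⇒≢ (homs-bundle>0⁺ A {Ls₁}
      (C>0 ∷ All.map⁺ (All.map (λ col → coloured-homs>0 {A = A} col C>0) (family-coloured C n)))) zero₁

    edgeless : ∀ {A : Adj n} → Symmetric A → homs A F₂ ≡ 0 → ∀ u v → A u v ≡ false
    edgeless {A} symA zero₂ u v = ¬-not λ Auv → >⇒≢ (homs-bundle>0⁺ A {Ls₂} (all>0 (subst T (sym Auv) tt))) zero₂
      where
      all>0 : T (A u v) → All (λ (_ , L) → homs A L > 0) Ls₂
      all>0 uv = two-coloured-homs>0 symA {K₂} {λ { zero → true ; (suc _) → false }} (refl ∷ []) uv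
               ∷ All.map⁺ (All.map (λ (_ , two) → two-coloured-homs>0 symA two uv) two-coloured)

    embeds : ∀ {A B : Adj n} → Symmetric A → Symmetric B →
             homs A F₁ ≡ homs B F₁ → homs A F₂ ≡ homs B F₂ → Embeds A B
    embeds {A} {B} symA symB eq₁ eq₂ = cases (0 <? homs A F₁) (0 <? homs A F₂)
      where
      cases : Dec (homs A F₁ > 0) → Dec (homs A F₂ > 0) → Embeds A B
      cases (yes pos₁) _          = embeds₁ symA symB pos₁ eq₁
      cases (no ¬pos₁) (yes pos₂) =
        let zero₁ = ≯0⇒≡0 ¬pos₁
        in embeds₂ symA symB (C-count A zero₁) (C-count B (trans (sym eq₁) zero₁)) pos₂ eq₂
      -- Neither graph has an edge, so the identity is an isomorphism.
      cases (no _)     (no ¬pos₂) = id , id , λ u v →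
        let zero₂ = ≯0⇒≡0 ¬pos₂
        in trans (edgeless symA zero₂ u v) (sym (edgeless symB (trans (sym eq₂) zero₂) u v))

-- An isolated vertex is added because a Graph has at least one vertex by construction.
graph : ∀ {k} {F : Pattern k} → Loopless F → Graph
graph {F = F} loopless = asGraph (rename suc F) (rename-loopless suc-injective loopless)

hom-graph : ∀ {k} {F : Pattern k} (loopless : Loopless F) G → hom (graph loopless) G ≡ ∣V∣ G * homs (adj G) F
hom-graph {F = F} loopless G = trans (hom-asGraph (rename suc F) (rename-loopless suc-injective loopless) G) (homs-rename-suc (adj G) F)

graphs-determine : ∀ {n k l} {F₁ : Pattern k} {F₂ : Pattern l} (loopless₁ : Loopless F₁) (loopless₂ : Loopless F₂) →
  (∀ {A B : Adj n} → Symmetric A → Symmetric B → homs A F₁ ≡ homs B F₁ → homs A F₂ ≡ homs B F₂ → Embeds A B) →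
  (G H : Graph) → ∣V∣ G ≡ n → ∣V∣ H ≡ n →
  hom (graph loopless₁) G ≡ hom (graph loopless₁) H → hom (graph loopless₂) G ≡ hom (graph loopless₂) H → G ≅ H
graphs-determine loopless₁ loopless₂ embeds G@record{} H@record{} refl refl eq₁ eq₂ =
  isomorphism {A = adj G} {adj H} (embeds (symm G) (symm H) (cancel loopless₁ eq₁) (cancel loopless₂ eq₂))
  where
  cancel : ∀ {k} {F : Pattern k} (loopless : Loopless F) →
           hom (graph loopless) G ≡ hom (graph loopless) H → homs (adj G) F ≡ homs (adj H) F
  -- The isolated vertex contributes the same positive factor on both sides, because the orders of
  -- `G` and `H` are equal.
  cancel loopless eq = *-cancelˡ-≡ _ _ (∣V∣ G)
    (trans (sym (hom-graph loopless G)) (trans eq (hom-graph loopless H)))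

theorem8p3 : (n : ℕ) → n ≥ 1 →
    Σ Graph λ F₁ → Σ Graph λ F₂ →
    (G H : Graph) → ∣V∣ G ≡ n → ∣V∣ H ≡ n →
    hom F₁ G ≡ hom F₁ H → hom F₂ G ≡ hom F₂ H → G ≅ H
theorem8p3 (suc n′) _ = graph loopless₁ , graph loopless₂ , graphs-determine loopless₁ loopless₂ embeds
  where open Construction n′
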